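{- Let $\mathcal{H}=(\mathcal{U},\mathcal{N})$ be a hypergraph with net set $\mathcal{N}=\{n_i\}$, let $\mathcal{G}=(\mathcal{V},\mathcal{E})$ be its net intersection graph, whose vertex $v_i$ corresponds to the net $n_i$, and let $K\ge 2$. Let $\{\mathcal{V}_1,\ldots,\mathcal{V}_K;\mathcal{V}_S\}$ be a $K$-way vertex partition of $\mathcal{G}$ by a narrow vertex separator $\mathcal{V}_S$. Put $\mathcal{N}_k=\{n_i: v_i\in\mathcal{V}_k\}$ for $1\le k\le K$ and $\mathcal{N}_S=\{n_i: v_i\in\mathcal{V}_S\}$. Let $\{\mathcal{U}_1,\ldots,\mathcal{U}_K\}$ be any partition of the node set $\mathcal{U}$ such that $\mathcal{U}_k\supseteq Pins(\mathcal{N}_k)$ for every $1\le k\le K$. Then $\{\mathcal{U}_1,\ldots,\mathcal{U}_K\}$ induces the $(K+1)$-way net partition $\{\mathcal{N}_1,\ldots,\mathcal{N}_K;\mathcal{N}_S\}$, that is, $\mathcal{N}_k$ is exactly the set of internal nets of $\mathcal{U}_k$ for each $k$ and $\mathcal{N}_S$ is exactly the set of cut nets; and for each cut net $n_s\in\mathcal{N}_S$, its connectivity satisfies $\lambda(n_s)\ge\lambda(v_s)$, where $\lambda(v_s)$ is the connectivity of the corresponding separator vertex $v_s\in\mathcal{V}_S$.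
   Context: All graphs and hypergraphs are finite. A hypergraph $\mathcal{H}=(\mathcal{U},\mathcal{N})$ consists of a set $\mathcal{U}$ of nodes and a set $\mathcal{N}$ of nets; each net $n_i$ connects a nonempty set of nodes $Pins(n_i)\subseteq\mathcal{U}$. Distinct nets may have the same pin set. For $\mathcal{N}'\subseteq\mathcal{N}$, $Pins(\mathcal{N}')=\bigcup_{n_i\in\mathcal{N}'}Pins(n_i)$. The net intersection graph (NIG) of $\mathcal{H}$ is the simple undirected graph $\mathcal{G}=(\mathcal{V},\mathcal{E})$ with one vertex $v_i$ for each net $n_i$, in which distinct vertices $v_i,v_j$ are adjacent if and only if $Pins(n_i)\cap Pins(n_j)\neq\emptyset$. For a vertex subset $\mathcal{V}'$, $Adj(\mathcal{V}')$ is the set of vertices outside $\mathcal{V}'$ adjacent to some vertex of $\mathcal{V}'$. A set $\mathcal{V}_S\subset\mathcal{V}$ is a $K$-way vertex separator if the subgraph induced by $\mathcal{V}-\mathcal{V}_S$ has at least $K$ connected components. A $K$-way vertex partition $\{\mathcal{V}_1,\ldots,\mathcal{V}_K;\mathcal{V}_S\}$ of $\mathcal{G}$ by vertex separator $\mathcal{V}_S$ means: each $\mathcal{V}_k$ is nonempty; $\mathcal{V}_1,\ldots,\mathcal{V}_K,\mathcal{V}_S$ are pairwise disjoint with union $\mathcal{V}$; and $Adj(\mathcal{V}_k)\cap\mathcal{V}_\ell=\emptyset$ for $k\ne\ell$. A $K$-way vertex separator is narrow if no proper subset of it is a $K$-way vertex separator. The connectivity $\lambda(v)$ of a separator vertex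 $v\in\mathcal{V}_S$ is the number of parts $\mathcal{V}_k$ ($1\le k\le K$) containing at least one vertex adjacent to $v$. For a partition $\{\mathcal{U}_1,\ldots,\mathcal{U}_K\}$ of $\mathcal{U}$ into nonempty pairwise disjoint parts, the connectivity $\lambda(n)$ of a net $n$ is the number of parts $\mathcal{U}_k$ with $Pins(n)\cap\mathcal{U}_k\ne\emptyset$. A net is cut (external) if $\lambda(n)>1$ and internal if $\lambda(n)=1$; an internal net is an internal net of the part $\mathcal{U}_k$ that contains all its pins. The net partition induced by $\{\mathcal{U}_1,\ldots,\mathcal{U}_K\}$ consists of the sets of internal nets of $\mathcal{U}_1,\ldots,\mathcal{U}_K$ together with the set of cut nets. -}

module Defs where

open import Data.Fin using (Fin)
open import Data.Fin.Properties using (_≟_; any?)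
open import Data.Fin.Subset using (Subset; _∈_; _∉_; _∩_; _⊆_; _⊂_; ∁; Nonempty; Empty)
open import Data.Fin.Subset.Properties using (_∈?_; nonempty?; ∩-comm)
open import Data.Nat using (ℕ; _>_)
open import Data.Product using (_×_; ∃; _,_; proj₁)
open import Data.Sum using (_⊎_)
open import Data.Vec using (count; allFin)
open import Function using (_⇔_)
open import Function.Definitions using (Injective)
open import Level using (0ℓ)
open import Relation.Binary using (Rel; Symmetric; Irreflexive; Decidable)
open import Relation.Binary.Construct.Closure.ReflexiveTransitive using (Star)
open import Relation.Binary.PropositionalEquality using (_≡_; _≢_; subst; ≢-sym)
open import Relation.Nullary using (¬_; ¬?)
open import Relation.Nullary.Decidable using (_×-dec_)
open import Relation.Unary using (Pred)

record Hypergraph (u m : ℕ) : Set where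
  field
    pins          : Fin m → Subset u
    pins-nonempty : ∀ i → Nonempty (pins i)

  Pins : Subset m → Pred (Fin u) 0ℓ
  Pins N x = ∃ λ i → i ∈ N × x ∈ pins i

record Graph (n : ℕ) : Set₁ where
  field
    Adjacent  : Rel (Fin n) 0ℓ
    adjacent? : Decidable Adjacent
    symmetric : Symmetric Adjacent
    loopless  : Irreflexive _≡_ Adjacent

-- Net i and its vertex are the same element of Fin m, so a set of nets and the
-- corresponding set of vertices are the same Subset m.
NIG : ∀ {u m} → Hypergraph u m → Graph m
NIG H = record
  { Adjacent  = λ i j → i ≢ j × Nonempty (pins i ∩ pins j)
  ; adjacent? = λ i j → ¬? (i ≟ j) ×-dec nonempty? (pins i ∩ pins j)
  ; symmetric = λ {i} {j} (i≢j , meet) → ≢-sym i≢j , subst Nonempty (∩-comm (pins i) (pins j)) meet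
  ; loopless  = λ i≡j adj → proj₁ adj i≡j
  }
  where open Hypergraph H

module _ {n : ℕ} (G : Graph n) where
  open Graph G

  Adj : Subset n → Pred (Fin n) 0ℓ
  Adj V v = v ∉ V × ∃ λ w → w ∈ V × Adjacent w v

  InducedEdge : Subset n → Rel (Fin n) 0ℓ
  InducedEdge W v w = v ∈ W × w ∈ W × Adjacent v w

  -- The components of the subgraph induced by W are the sets of vertices reachable,
  -- by walks inside W, from some vertex of W.
  IsComponent : Subset n → Subset n → Set
  IsComponent W C = ∃ λ x → x ∈ W × (∀ y → y ∈ C ⇔ Star (InducedEdge W) x y)

  HasAtLeastComponents : ℕ → Subset n → Set
  HasAtLeastComponents K W =
    ∃ λ (C : Fin K → Subset n) → Injective _≡_ _≡_ C × (∀ k → IsComponent W (C k))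

  IsSeparator : ℕ → Subset n → Set
  IsSeparator K S = HasAtLeastComponents K (∁ S)

  IsNarrowSeparator : ℕ → Subset n → Set
  IsNarrowSeparator K S = IsSeparator K S × (∀ T → T ⊂ S → ¬ IsSeparator K T)

  record IsVertexPartition {K : ℕ} (V : Fin K → Subset n) (S : Subset n) : Set where
    field
      nonempty           : ∀ k → Nonempty (V k)
      disjoint           : ∀ {k l} → k ≢ l → Empty (V k ∩ V l)
      disjoint-separator : ∀ k → Empty (V k ∩ S)
      cover              : ∀ v → v ∈ S ⊎ ∃ λ k → v ∈ V k
      nonadjacent        : ∀ {k l} → k ≢ l → ∀ v → Adj (V k) v → v ∉ V l

  -- Only meaningful for v in the separator of the partition with parts V.
  vertexConnectivity : ∀ {K} → (Fin K → Subset n) → Fin n → ℕ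
  vertexConnectivity V v = count (λ k → any? (λ w → w ∈? V k ×-dec adjacent? v w)) (allFin _)

record IsPartition {u K : ℕ} (P : Fin K → Subset u) : Set where
  field
    nonempty : ∀ k → Nonempty (P k)
    disjoint : ∀ {k l} → k ≢ l → Empty (P k ∩ P l)
    cover    : ∀ x → ∃ λ k → x ∈ P k

module _ {u m K : ℕ} (H : Hypergraph u m) (P : Fin K → Subset u) where
  open Hypergraph H

  netConnectivity : Fin m → ℕ
  netConnectivity i = count (λ k → nonempty? (pins i ∩ P k)) (allFin K)

  IsCut : Fin m → Set
  IsCut i = netConnectivity i > 1

  IsInternal : Fin m → Set
  IsInternal i = netConnectivity i ≡ 1

  IsInternalTo : Fin K → Fin m → Set
  IsInternalTo k i = IsInternal i × pins i ⊆ P k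

  Induces : (Fin K → Subset m) → Subset m → Set
  Induces N S = (∀ k i → i ∈ N k ⇔ IsInternalTo k i) × (∀ i → i ∈ S ⇔ IsCut i)

{-# OPTIONS --safe #-}

-- A net of V k has all its pins in U k, so it is internal to U k.  A separator vertex s
-- must see at least two parts: otherwise moving s into the only part it sees (or into
-- any part) leaves K mutually nonadjacent nonempty parts, so S - s is already a K-way
-- separator, against narrowness.  A separator net shares a pin with U k whenever its
-- vertex sees V k; hence it is cut, with at least the connectivity of its vertex.
module Submission where

open import Defs
open import Data.Bool using (true; false)
open import Data.Fin using (Fin; zero; suc)
open import Data.Fin.Properties using (_≟_; any?; sequence)
open import Data.Fin.Subset using (Subset; _∈_; _∉_; _∩_; _-_; ∁; Nonempty; ∣_∣; ⁅_⁆)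
open import Data.Fin.Subset.Properties
  using (_∈?_; nonempty?; x∈⁅x⁆; x∈⁅y⁆⇒x≡y; ∣⁅x⁆∣≡1; p⊆q⇒∣p∣≤∣q∣; p⊂q⇒∣p∣<∣q∣; x∈p∩q⁺; x∈p∩q⁻;
         x∉p⇒x∈∁p; x∈∁p⇒x∉p; x∈p⇒p-x⊂p; x∈p∧x≢y⇒x∈p-y; p─q⊆p)
open import Data.Nat using (ℕ; zero; suc; _≤_; _≥_; _<_)
open import Data.Nat.Properties using (≤-antisym; <-irrefl)
open import Data.Product using (_×_; ∃; ∃₂; _,_; proj₁; proj₂)
open import Data.Sum using (_⊎_; inj₁; inj₂)
open import Data.Vec using (count; allFin; tabulate)
open import Data.Vec.Properties using ([]=⇒lookup; lookup⇒[]=; lookup∘tabulate)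
open import Effect.Monad using (RawMonad)
open import Function using (_∘_; id; _⇔_; mk⇔; Equivalence)
open import Level using (0ℓ)
open import Relation.Binary.Construct.Closure.ReflexiveTransitive using (Star; ε; fold)
open import Relation.Binary.PropositionalEquality
open import Relation.Nullary using (Dec; yes; no; does; ¬_; ¬?; contradiction)
open import Relation.Nullary.Decidable using (_×-dec_; dec-true; ¬¬-excluded-middle; decidable-stable)
open import Relation.Nullary.Negation using (¬¬-Monad; ¬¬-map)
open import Relation.Unary using (Pred; Decidable; _⊆_)

comprehension : ∀ {n} {P : Pred (Fin n) 0ℓ} → Decidable P → Subset n
comprehension P? = tabulate (does ∘ P?)

∈-comprehension : ∀ {n} {P : Pred (Fin n) 0ℓ} (P? : Decidable P) x → x ∈ comprehension P? ⇔ P x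
∈-comprehension {P = P} P? x = mk⇔
  (λ x∈ → witness (P? x) (trans (sym (lookup∘tabulate (does ∘ P?) x)) ([]=⇒lookup x∈)))
  (λ Px → lookup⇒[]= x _ (trans (lookup∘tabulate (does ∘ P?) x) (dec-true (P? x) Px)))
  where
  witness : ∀ {A : Set} (a? : Dec A) → does a? ≡ true → A
  witness (yes a) _ = a

module _ {n} {P : Pred (Fin n) 0ℓ} (P? : Decidable P) {x : Fin n} where
  open Equivalence (∈-comprehension P? x) public
    renaming (to to ∈-comprehension⁻; from to ∈-comprehension⁺)

-- Both connectivities are counts over `allFin`; turning them into cardinalities lets inclusions of
-- subsets bound them.
∣comprehension∣≡count : ∀ {n} {P : Pred (Fin n) 0ℓ} (P? : Decidable P) →
                        ∣ comprehension P? ∣ ≡ count P? (allFin n)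
∣comprehension∣≡count P? = go id
  where
  -- Generalised from `id` to any `f`, since the recursion passes to `f ∘ suc`.
  go : ∀ {k} (f : Fin k → Fin _) →
       ∣ tabulate (does ∘ P? ∘ f) ∣ ≡ count P? (tabulate f)
  go {zero} f = refl
  go {suc k}  f with does (P? (f zero))
  ... | true  = cong suc (go (f ∘ suc))
  ... | false = go (f ∘ suc)

module _ {n} {P : Pred (Fin n) 0ℓ} (P? : Decidable P) where

  count-mono-≤ : ∀ {Q : Pred (Fin n) 0ℓ} (Q? : Decidable Q) → P ⊆ Q →
                 count P? (allFin n) ≤ count Q? (allFin n)
  count-mono-≤ Q? P⊆Q = subst₂ _≤_ (∣comprehension∣≡count P?) (∣comprehension∣≡count Q?)
    (p⊆q⇒∣p∣≤∣q∣ (λ x∈ → ∈-comprehension⁺ Q? (P⊆Q (∈-comprehension⁻ P? x∈))))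

  ⁅x⁆⊆comprehension : ∀ {x y} → P x → y ∈ ⁅ x ⁆ → y ∈ comprehension P?
  ⁅x⁆⊆comprehension Px y∈ rewrite x∈⁅y⁆⇒x≡y _ y∈ = ∈-comprehension⁺ P? Px

  count-unique : ∀ {x} → P x → (∀ {y} → P y → y ≡ x) → count P? (allFin n) ≡ 1
  count-unique {x} Px unique = begin
    count P? (allFin n)    ≡⟨ ∣comprehension∣≡count P? ⟨
    ∣ comprehension P? ∣   ≡⟨ ≤-antisym (p⊆q⇒∣p∣≤∣q∣ ⊆⁅x⁆) (p⊆q⇒∣p∣≤∣q∣ (⁅x⁆⊆comprehension Px)) ⟩
    ∣ ⁅ x ⁆ ∣              ≡⟨ ∣⁅x⁆∣≡1 x ⟩
    1                      ∎
    where
    open ≡-Reasoning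
    ⊆⁅x⁆ : ∀ {y} → y ∈ comprehension P? → y ∈ ⁅ x ⁆
    ⊆⁅x⁆ y∈ = subst (_∈ ⁅ x ⁆) (sym (unique (∈-comprehension⁻ P? y∈))) (x∈⁅x⁆ x)

  count>1 : ∀ {x y} → x ≢ y → P x → P y → 1 < count P? (allFin n)
  count>1 {x} {y} x≢y Px Py = subst₂ _<_ (∣⁅x⁆∣≡1 x) (∣comprehension∣≡count P?)
    (p⊂q⇒∣p∣<∣q∣ (⁅x⁆⊆comprehension Px , y , ∈-comprehension⁺ P? Py , x≢y ∘ sym ∘ x∈⁅y⁆⇒x≡y x))

-- Double-negation shift, valid here because the index set is finite.
Fin-¬¬-∀ : ∀ {n} {P : Pred (Fin n) 0ℓ} → (∀ i → ¬ ¬ P i) → ¬ ¬ (∀ i → P i)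
Fin-¬¬-∀ = sequence (RawMonad.rawApplicative ¬¬-Monad)

-- The double negation replaces a decision procedure for reachability, which would be
-- needed to exhibit the components as subsets.
¬¬-components : ∀ {n K} (G : Graph n) (W : Subset n) (part : Fin n → Fin K) →
  (∀ k → ∃ λ x → x ∈ W × part x ≡ k) →
  (∀ {v w} → InducedEdge G W v w → part v ≡ part w) →
  ¬ ¬ HasAtLeastComponents G K W
¬¬-components {K = K} G W part rep edge⇒≡ =
  ¬¬-map components (Fin-¬¬-∀ λ k → Fin-¬¬-∀ λ y → ¬¬-excluded-middle)
  where
  root : Fin K → Fin _
  root k = proj₁ (rep k)

  Reachable : Fin K → Pred (Fin _) 0ℓ
  Reachable k = Star (InducedEdge G W) (root k)

  -- Edges preserve `part`, so it is constant along every walk from `root k`.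
  reachable⇒≡ : ∀ {k y} → Reachable k y → part y ≡ k
  reachable⇒≡ {k} r =
    trans (sym (fold (λ v w → part v ≡ part w) (trans ∘ edge⇒≡) refl r)) (proj₂ (proj₂ (rep k)))

  components : (∀ k → Decidable (Reachable k)) → HasAtLeastComponents G K W
  components reachable? =
    C , C-injective , λ k → root k , proj₁ (proj₂ (rep k)) , ∈-comprehension (reachable? k)
    where
    C : Fin K → Subset _
    C k = comprehension (reachable? k)

    -- If the components agree, `root k` is reachable from `root l` and so has both labels `k` and
    -- `l`.
    C-injective : ∀ {k l} → C k ≡ C l → k ≡ l
    C-injective {k} {l} Ck≡Cl = trans (sym (reachable⇒≡ {k} ε))
      (reachable⇒≡ (∈-comprehension⁻ (reachable? l)
        (subst (root k ∈_) Ck≡Cl (∈-comprehension⁺ (reachable? k) ε))))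

module _ {n K} (G : Graph n) {V : Fin K → Subset n} {S : Subset n}
         (partition : IsVertexPartition G V S) where
  open Graph G
  open IsVertexPartition partition

  Sees : Fin n → Pred (Fin K) 0ℓ
  Sees v k = ∃ λ w → w ∈ V k × Adjacent v w

  sees? : ∀ v → Decidable (Sees v)
  sees? v k = any? λ w → w ∈? V k ×-dec adjacent? v w

  part-unique : ∀ {v k l} → v ∈ V k → v ∈ V l → k ≡ l
  part-unique {k = k} {l} v∈k v∈l =
    decidable-stable (k ≟ l) λ k≢l → disjoint k≢l (_ , x∈p∩q⁺ (v∈k , v∈l))

  -- `Adj (V k)` has only vertices outside `V k`, so uniqueness of the part of `w` is used before
  -- `nonadjacent` applies.
  adjacent⇒same-part : ∀ {v w k l} → v ∈ V k → w ∈ V l → Adjacent v w → k ≡ l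
  adjacent⇒same-part {v} {w} {k} {l} v∈k w∈l adj = decidable-stable (k ≟ l) λ k≢l →
    nonadjacent k≢l w ((λ w∈k → k≢l (part-unique w∈k w∈l)) , v , v∈k , adj) w∈l

  -- Once `s` joins part `k₀`, no edge outside `S - s` links two parts. If `s` sees no part at all,
  -- any `k₀` qualifies.
  separable-without : ∀ {s} (k₀ : Fin K) → (∀ {k} → Sees s k → k ≡ k₀) →
                      ¬ ¬ IsSeparator G K (S - s)
  separable-without {s} k₀ only = ¬¬-components G (∁ (S - s)) part rep edge⇒≡
    where
    assign : ∀ {v} → v ∈ S ⊎ (∃ λ k → v ∈ V k) → Fin K
    -- This labels all of `S`, but `s` is its only vertex outside `S - s`.
    assign (inj₁ _)       = k₀
    assign (inj₂ (k , _)) = k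

    part : Fin n → Fin K
    part v = assign (cover v)

    rep : ∀ k → ∃ λ x → x ∈ ∁ (S - s) × part x ≡ k
    rep k with x , x∈k ← nonempty k = x , x∉p⇒x∈∁p (x∉S ∘ p─q⊆p S ⁅ s ⁆) , part≡k
      where
      x∉S : x ∉ S
      x∉S x∈S = disjoint-separator k (x , x∈p∩q⁺ (x∈k , x∈S))
      part≡k : part x ≡ k
      part≡k with cover x
      ... | inj₁ x∈S       = contradiction x∈S x∉S
      ... | inj₂ (_ , x∈l) = part-unique x∈l x∈k

    separator-remnant : ∀ {v} → v ∈ ∁ (S - s) → v ∈ S → v ≡ s
    separator-remnant {v} v∈∁ v∈S = decidable-stable (v ≟ s) λ v≢s →
      x∈∁p⇒x∉p v∈∁ (x∈p∧x≢y⇒x∈p-y v∈S v≢s)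

    edge⇒≡ : ∀ {v w} → InducedEdge G (∁ (S - s)) v w → part v ≡ part w
    edge⇒≡ {v} {w} (v∈∁ , w∈∁ , adj) with cover v | cover w
    ... | inj₁ _         | inj₁ _         = refl
    ... | inj₁ v∈S       | inj₂ (l , w∈l) rewrite separator-remnant v∈∁ v∈S =
          sym (only (w , w∈l , adj))
    ... | inj₂ (k , v∈k) | inj₁ w∈S       rewrite separator-remnant w∈∁ w∈S =
          only (v , v∈k , symmetric adj)
    ... | inj₂ (k , v∈k) | inj₂ (l , w∈l) = adjacent⇒same-part v∈k w∈l adj

  module _ (narrow : IsNarrowSeparator G K S) {s : Fin n} (s∈S : s ∈ S) where

    -- Narrowness is a negation, so it refutes even a doubly negated separator `S - s`; the search
    -- over the finitely many parts then yields an actual witness.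
    sees-another : ∀ k₀ → ∃ λ k → k ≢ k₀ × Sees s k
    sees-another k₀ with any? (λ k → ¬? (k ≟ k₀) ×-dec sees? s k)
    ... | yes another = another
    ... | no  none    = contradiction (proj₂ narrow (S - s) (x∈p⇒p-x⊂p s∈S))
      (separable-without k₀ λ {k} sees → decidable-stable (k ≟ k₀) λ k≢k₀ → none (k , k≢k₀ , sees))

    sees-two : Fin K → ∃₂ λ k l → k ≢ l × Sees s k × Sees s l
    -- The index `k₀` is only a seed: the first call finds some seen part `k`, the second a seen
    -- part other than `k`.
    sees-two k₀ with k , _   , sees-k ← sees-another k₀
                with l , l≢k , sees-l ← sees-another k  = k , l , ≢-sym l≢k , sees-k , sees-l

theorem2 : ∀ {u m : ℕ} (H : Hypergraph u m) (K : ℕ) → 2 ≤ K →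
    (V : Fin K → Subset m) (S : Subset m) →
    IsVertexPartition (NIG H) V S →
    IsNarrowSeparator (NIG H) K S →
    (U : Fin K → Subset u) →
    IsPartition U →
    (∀ k → Hypergraph.Pins H (V k) ⊆ (_∈ U k)) →
    Induces H U V S ×
    (∀ s → s ∈ S → netConnectivity H U s ≥ vertexConnectivity (NIG H) V s)
theorem2 {m = m} H K@(suc _) _ V S partition narrow U U-partition Pins⊆U =
  ((λ k i → mk⇔ (λ i∈k → internal i∈k , λ {_} x∈i → Pins⊆U k (i , i∈k , x∈i)) (internal⇒∈ k i)) ,
   (λ i → mk⇔ cut (cut⇒∈ i))) ,
  λ s _ → count-mono-≤ (sees? (NIG H) partition s) (meets? s) sees⇒meets
  where
  open Hypergraph H
  open IsVertexPartition partition using (cover)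

  Meets : Fin m → Pred (Fin K) 0ℓ
  Meets i k = Nonempty (pins i ∩ U k)

  meets? : ∀ i → Decidable (Meets i)
  meets? i k = nonempty? (pins i ∩ U k)

  node-part-unique : ∀ {x k l} → x ∈ U k → x ∈ U l → k ≡ l
  node-part-unique {k = k} {l} x∈k x∈l =
    decidable-stable (k ≟ l) λ k≢l → IsPartition.disjoint U-partition k≢l (_ , x∈p∩q⁺ (x∈k , x∈l))

  sees⇒meets : ∀ {s k} → Sees (NIG H) partition s k → Meets s k
  sees⇒meets {s} {k} (w , w∈k , _ , x , x∈s∩w) with x∈s , x∈w ← x∈p∩q⁻ (pins s) (pins w) x∈s∩w =
    x , x∈p∩q⁺ (x∈s , Pins⊆U k (w , w∈k , x∈w))

  internal : ∀ {i k} → i ∈ V k → IsInternal H U i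
  internal {i} {k} i∈k = count-unique (meets? i)
    (let x , x∈i = pins-nonempty i in x , x∈p∩q⁺ (x∈i , Pins⊆U k (i , i∈k , x∈i)))
    λ {l} (y , y∈i∩l) → let y∈i , y∈l = x∈p∩q⁻ (pins i) (U l) y∈i∩l in
      node-part-unique y∈l (Pins⊆U k (i , i∈k , y∈i))

  cut : ∀ {i} → i ∈ S → IsCut H U i
  -- Any index can seed `sees-two`; `zero` exists because `K` is matched as a successor.
  cut {i} i∈S with k , l , k≢l , sees-k , sees-l ← sees-two (NIG H) partition narrow i∈S zero =
    count>1 (meets? i) k≢l (sees⇒meets sees-k) (sees⇒meets sees-l)

  -- By `cover` the net lies in `S` or in some `V l`. The first would make it cut; in the second,
  -- any of its pins lies in both `U l` and `U k`, forcing `l ≡ k`.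
  internal⇒∈ : ∀ k i → IsInternalTo H U k i → i ∈ V k
  internal⇒∈ k i (λ≡1 , i⊆k) with cover i
  ... | inj₁ i∈S       = contradiction (cut i∈S) (<-irrefl (sym λ≡1))
  ... | inj₂ (l , i∈l) with x , x∈i ← pins-nonempty i =
        subst (λ j → i ∈ V j) (node-part-unique (Pins⊆U l (i , i∈l , x∈i)) (i⊆k x∈i)) i∈l

  cut⇒∈ : ∀ i → IsCut H U i → i ∈ S
  cut⇒∈ i λ>1 with cover i
  ... | inj₁ i∈S       = i∈S
  ... | inj₂ (_ , i∈k) = contradiction λ>1 (<-irrefl (sym (internal i∈k)))
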